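{- Let $H$ be a complex Hadamard matrix of order $n$, and let $T$ be a trade in $H$. Then $|T|\ge n$.
   Context: A complex Hadamard matrix of order $n$ is an $n\times n$ matrix with all entries of modulus $1$ and $HH^{\ast}=nI_n$. A trade in $H$ is a nonempty set $T$ of positions (entries) of $H$ which can be altered to obtain a different complex Hadamard matrix, i.e. there is a complex Hadamard matrix $K$ of order $n$ with $K_{ij}\neq H_{ij}$ for $(i,j)\in T$ and $K_{ij}=H_{ij}$ for $(i,j)\notin T$. The size of $T$ is its number of entries $|T|$. -}

module Defs where

open import Algebra.Bundles.Raw using (RawRing)
import Algebra.Definitions.RawMonoid as RawMonoidDefs
open import Data.Bool.Base using (if_then_else_)
open import Data.Fin.Base using (Fin; combine)
open import Data.Fin.Properties using () renaming (_≟_ to _≟ᶠ_)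
open import Data.Fin.Subset using (Subset; Nonempty; _∈_; _∉_)
open import Data.Integer.Base using (+_)
open import Data.Nat.Base as ℕ using (ℕ)
import Data.Nat.Properties as ℕₚ
open import Data.Product.Base using (Σ; ∃; _×_; _,_)
open import Data.Rational.Base
open import Data.Rational.Properties
open import Data.Rational.Solver using (module +-*-Solver)
open import Level using (0ℓ)
open import Relation.Binary.PropositionalEquality
  using (_≡_; refl; sym; trans; cong; cong₂; subst)
open import Relation.Nullary.Decidable.Core using (does)

-- Real numbers: Cauchy sequences of rationals modulo null sequences.
-- There are no quotients, so ℝ is used through the equivalence _≈ℝ_.

IsCauchy : (ℕ → ℚ) → Set
IsCauchy x = ∀ ε → 0ℚ < ε →
  ∃ λ N → ∀ m n → N ℕ.≤ m → N ℕ.≤ n → ∣ x m - x n ∣ < ε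

record ℝ : Set where
  constructor mkℝ
  field
    seq    : ℕ → ℚ
    cauchy : IsCauchy seq

open ℝ public

infix 4 _≈ℝ_ _≤ℝ_

_≈ℝ_ : ℝ → ℝ → Set
x ≈ℝ y = ∀ ε → 0ℚ < ε →
  ∃ λ N → ∀ n → N ℕ.≤ n → ∣ seq x n - seq y n ∣ < ε

_≤ℝ_ : ℝ → ℝ → Set
x ≤ℝ y = ∀ ε → 0ℚ < ε →
  ∃ λ N → ∀ n → N ℕ.≤ n → seq x n < seq y n + ε

private
  half-pos : ∀ {ε} → 0ℚ < ε → 0ℚ < ½ * ε
  half-pos {ε} 0<ε =
    positive⁻¹ (½ * ε) {{pos*pos⇒pos ½ ε {{positive 0<ε}}}}

  half+half : ∀ ε → ½ * ε + ½ * ε ≡ ε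
  half+half ε = trans (sym (*-distribʳ-+ ε ½ ½)) (*-identityˡ ε)

  const-cauchy : ∀ q → IsCauchy (λ _ → q)
  const-cauchy q ε 0<ε =
    0 , λ _ _ _ _ → subst (λ p → ∣ p ∣ < ε) (sym (+-inverseʳ q)) 0<ε

  +-cauchy : ∀ x y → IsCauchy x → IsCauchy y →
             IsCauchy (λ n → x n + y n)
  +-cauchy x y cx cy ε 0<ε
    with cx (½ * ε) (half-pos 0<ε) | cy (½ * ε) (half-pos 0<ε)
  ... | M , hx | N , hy = M ℕ.⊔ N , λ m n p q → begin-strict
    ∣ (x m + y m) - (x n + y n) ∣
      ≡⟨ cong ∣_∣ (regroup (x m) (y m) (x n) (y n)) ⟩
    ∣ (x m - x n) + (y m - y n) ∣
      ≤⟨ ∣p+q∣≤∣p∣+∣q∣ (x m - x n) (y m - y n) ⟩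
    ∣ x m - x n ∣ + ∣ y m - y n ∣
      <⟨ +-mono-<
           (hx m n (ℕₚ.m⊔n≤o⇒m≤o M N p) (ℕₚ.m⊔n≤o⇒m≤o M N q))
           (hy m n (ℕₚ.m⊔n≤o⇒n≤o M N p) (ℕₚ.m⊔n≤o⇒n≤o M N q)) ⟩
    ½ * ε + ½ * ε
      ≡⟨ half+half ε ⟩
    ε ∎
    where
    open ≤-Reasoning
    regroup : ∀ a b c d → (a + b) - (c + d) ≡ (a - c) + (b - d)
    regroup = +-*-Solver.solve 4
      (λ a b c d → (a :+ b) :- (c :+ d) := (a :- c) :+ (b :- d)) refl
      where open +-*-Solver

  neg-cauchy : ∀ x → IsCauchy x → IsCauchy (λ n → - x n)
  neg-cauchy x cx ε 0<ε with cx ε 0<ε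
  ... | N , hx = N , λ m n p q →
    subst (_< ε)
      (trans (sym (∣-p∣≡∣p∣ (x m - x n)))
             (cong ∣_∣ (neg-distrib-+ (x m) (- x n))))
      (hx m n p q)

  eventually-bounded : ∀ {x} → IsCauchy x →
    ∃ λ B → 0ℚ < B × ∃ λ N → ∀ n → N ℕ.≤ n → ∣ x n ∣ ≤ B
  eventually-bounded {x} cx with cx 1ℚ (positive⁻¹ 1ℚ)
  ... | N , hx =
    1ℚ + ∣ x N ∣ , +-mono-<-≤ (positive⁻¹ 1ℚ) (0≤∣p∣ (x N)) ,
    N , λ n p → begin
      ∣ x n ∣                   ≡⟨ cong ∣_∣ (split (x n) (x N)) ⟩
      ∣ (x n - x N) + x N ∣     ≤⟨ ∣p+q∣≤∣p∣+∣q∣ (x n - x N) (x N) ⟩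
      ∣ x n - x N ∣ + ∣ x N ∣   ≤⟨ +-monoˡ-≤ ∣ x N ∣ (<⇒≤ (hx n N p ℕₚ.≤-refl)) ⟩
      1ℚ + ∣ x N ∣              ∎
    where
    open ≤-Reasoning
    split : ∀ a b → a ≡ (a - b) + b
    split = +-*-Solver.solve 2 (λ a b → a := (a :- b) :+ b) refl
      where open +-*-Solver

  product-bound : ∀ C → 0ℚ < C → ∀ a b c d {η} → ∣ a ∣ ≤ C → ∣ d ∣ ≤ C →
    ∣ b - d ∣ < η → ∣ a - c ∣ < η → ∣ a * b - c * d ∣ < C * (η + η)
  product-bound C 0<C a b c d {η} a≤C d≤C b-d<η a-c<η = begin-strict
    ∣ a * b - c * d ∣
      ≡⟨ cong ∣_∣ (regroup a b c d) ⟩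
    ∣ a * (b - d) + d * (a - c) ∣
      ≤⟨ ∣p+q∣≤∣p∣+∣q∣ (a * (b - d)) (d * (a - c)) ⟩
    ∣ a * (b - d) ∣ + ∣ d * (a - c) ∣
      ≡⟨ cong₂ _+_ (∣p*q∣≡∣p∣*∣q∣ a (b - d)) (∣p*q∣≡∣p∣*∣q∣ d (a - c)) ⟩
    ∣ a ∣ * ∣ b - d ∣ + ∣ d ∣ * ∣ a - c ∣
      ≤⟨ +-mono-≤ (scale ∣ b - d ∣ (0≤∣p∣ (b - d)) a≤C)
                  (scale ∣ a - c ∣ (0≤∣p∣ (a - c)) d≤C) ⟩
    C * ∣ b - d ∣ + C * ∣ a - c ∣
      ≡⟨ sym (*-distribˡ-+ C ∣ b - d ∣ ∣ a - c ∣) ⟩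
    C * (∣ b - d ∣ + ∣ a - c ∣)
      <⟨ *-monoʳ-<-pos C {{positive 0<C}} (+-mono-< b-d<η a-c<η) ⟩
    C * (η + η) ∎
    where
    open ≤-Reasoning
    regroup : ∀ a b c d → a * b - c * d ≡ a * (b - d) + d * (a - c)
    regroup = +-*-Solver.solve 4
      (λ a b c d → a :* b :- c :* d := a :* (b :- d) :+ d :* (a :- c)) refl
      where open +-*-Solver
    scale : ∀ {p} q → 0ℚ ≤ q → p ≤ C → p * q ≤ C * q
    scale q 0≤q = *-monoʳ-≤-nonNeg q {{nonNegative 0≤q}}

  divide : ∀ C ε → 0ℚ < C → 0ℚ < ε → ∃ λ η → 0ℚ < η × C * (η + η) ≡ ε
  divide C ε 0<C 0<ε = ½ * δ , half-pos 0<δ ,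
    trans (cong (C *_) (half+half δ))
      (trans (sym (*-assoc C (1/ C) ε))
        (trans (cong (_* ε) (*-inverseʳ C)) (*-identityˡ ε)))
    where
    instance
      C-positive : Positive C
      C-positive = positive 0<C
      C-nonZero : NonZero C
      C-nonZero = pos⇒nonZero C
    δ : ℚ
    δ = 1/ C * ε
    0<δ : 0ℚ < δ
    0<δ = positive⁻¹ δ
      {{pos*pos⇒pos (1/ C) {{1/pos⇒pos C}} ε {{positive 0<ε}}}}

  *-cauchy : ∀ x y → IsCauchy x → IsCauchy y →
             IsCauchy (λ n → x n * y n)
  *-cauchy x y cx cy ε 0<ε =
    let A , 0<A , K , bx = eventually-bounded cx
        B , 0<B , L , by = eventually-bounded cy
        C = A + B
        0<C = +-mono-< 0<A 0<B
        A≤C = subst (_≤ C) (+-identityʳ A) (+-monoʳ-≤ A (<⇒≤ 0<B))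
        B≤C = subst (_≤ C) (+-identityˡ B) (+-monoˡ-≤ B (<⇒≤ 0<A))
        η , 0<η , Cη+η≡ε = divide C ε 0<C 0<ε
        M , hx = cx η 0<η
        N , hy = cy η 0<η
        KL≤ : ∀ {o} → (K ℕ.⊔ L) ℕ.⊔ (M ℕ.⊔ N) ℕ.≤ o → K ℕ.⊔ L ℕ.≤ o
        KL≤ = ℕₚ.m⊔n≤o⇒m≤o (K ℕ.⊔ L) (M ℕ.⊔ N)
        MN≤ : ∀ {o} → (K ℕ.⊔ L) ℕ.⊔ (M ℕ.⊔ N) ℕ.≤ o → M ℕ.⊔ N ℕ.≤ o
        MN≤ = ℕₚ.m⊔n≤o⇒n≤o (K ℕ.⊔ L) (M ℕ.⊔ N)
    in (K ℕ.⊔ L) ℕ.⊔ (M ℕ.⊔ N) , λ m n p q →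
      subst (∣ x m * y m - x n * y n ∣ <_) Cη+η≡ε
        (product-bound C 0<C (x m) (y m) (x n) (y n)
          (≤-trans (bx m (ℕₚ.m⊔n≤o⇒m≤o K L (KL≤ p))) A≤C)
          (≤-trans (by n (ℕₚ.m⊔n≤o⇒n≤o K L (KL≤ q))) B≤C)
          (hy m n (ℕₚ.m⊔n≤o⇒n≤o M N (MN≤ p)) (ℕₚ.m⊔n≤o⇒n≤o M N (MN≤ q)))
          (hx m n (ℕₚ.m⊔n≤o⇒m≤o M N (MN≤ p)) (ℕₚ.m⊔n≤o⇒m≤o M N (MN≤ q))))

infixl 6 _+ℝ_ _-ℝ_
infixl 7 _*ℝ_
infix  8 -ℝ_

0ℝ 1ℝ : ℝ
0ℝ = mkℝ (λ _ → 0ℚ) (const-cauchy 0ℚ)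
1ℝ = mkℝ (λ _ → 1ℚ) (const-cauchy 1ℚ)

_+ℝ_ : ℝ → ℝ → ℝ
x +ℝ y = mkℝ (λ n → seq x n + seq y n)
             (+-cauchy (seq x) (seq y) (cauchy x) (cauchy y))

-ℝ_ : ℝ → ℝ
-ℝ x = mkℝ (λ n → - seq x n) (neg-cauchy (seq x) (cauchy x))

_-ℝ_ : ℝ → ℝ → ℝ
x -ℝ y = x +ℝ (-ℝ y)

_*ℝ_ : ℝ → ℝ → ℝ
x *ℝ y = mkℝ (λ n → seq x n * seq y n)
             (*-cauchy (seq x) (seq y) (cauchy x) (cauchy y))

infixr 5 _+i_

record ℂ : Set where
  constructor _+i_
  field
    re im : ℝ

open ℂ public

ℂ-rawRing : RawRing 0ℓ 0ℓ
ℂ-rawRing = record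
  { Carrier = ℂ
  ; _≈_     = λ z w → re z ≈ℝ re w × im z ≈ℝ im w
  ; _+_     = λ z w → (re z +ℝ re w) +i (im z +ℝ im w)
  ; _*_     = λ z w → (re z *ℝ re w -ℝ im z *ℝ im w)
                    +i (re z *ℝ im w +ℝ im z *ℝ re w)
  ; -_      = λ z → (-ℝ re z) +i (-ℝ im z)
  ; 0#      = 0ℝ +i 0ℝ
  ; 1#      = 1ℝ +i 0ℝ
  }

open RawRing ℂ-rawRing public using ()
  renaming ( _≈_ to _≈ℂ_; _≉_ to _≉ℂ_; _+_ to _+ℂ_; _*_ to _*ℂ_; -_ to -ℂ_
           ; 0# to 0ℂ; 1# to 1ℂ; +-rawMonoid to ℂ-+-rawMonoid )

open RawMonoidDefs ℂ-+-rawMonoid public using ()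
  renaming (sum to sumℂ; _×_ to _×ℂ_)

conj : ℂ → ℂ
conj z = re z +i (-ℝ im z)

-- r is the modulus √(re² + im²) of z, the square root being specified
-- by its defining property instead of being computed.
HasModulus : ℂ → ℝ → Set
HasModulus z r = 0ℝ ≤ℝ r × r *ℝ r ≈ℝ re z *ℝ re z +ℝ im z *ℝ im z

Matrix : ℕ → Set
Matrix n = Fin n → Fin n → ℂ

infix 4 _≈ᴹ_
infixl 7 _*ᴹ_
infixr 8 _×ᴹ_
infix  9 _ᴴ

_≈ᴹ_ : ∀ {n} → Matrix n → Matrix n → Set
A ≈ᴹ B = ∀ i j → A i j ≈ℂ B i j

_*ᴹ_ : ∀ {n} → Matrix n → Matrix n → Matrix n
(A *ᴹ B) i j = sumℂ λ k → A i k *ℂ B k j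

_ᴴ : ∀ {n} → Matrix n → Matrix n
(A ᴴ) i j = conj (A j i)

𝟙ᴹ : ∀ {n} → Matrix n
𝟙ᴹ i j = if does (i ≟ᶠ j) then 1ℂ else 0ℂ

_×ᴹ_ : ∀ {n} → ℕ → Matrix n → Matrix n
(m ×ᴹ A) i j = m ×ℂ A i j

IsComplexHadamard : ∀ {n} → Matrix n → Set
IsComplexHadamard {n} H =
  (∀ i j → HasModulus (H i j) 1ℝ) × H *ᴹ H ᴴ ≈ᴹ n ×ᴹ 𝟙ᴹ

-- A set of positions of an n × n matrix is a Subset (n * n), with the
-- position (i , j) identified with combine i j : Fin (n * n).
IsTrade : ∀ {n} → Matrix n → Subset (n ℕ.* n) → Set
IsTrade {n} H T = Nonempty T × Σ (Matrix n) λ K →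
  IsComplexHadamard K ×
  (∀ i j → combine i j ∈ T → K i j ≉ℂ H i j) ×
  (∀ i j → combine i j ∉ T → K i j ≈ℂ H i j)

{-# OPTIONS --safe #-}
module Submission where

-- Let D = K − H. By Parseval for H, each row dᵢ of D satisfies n ‖dᵢ‖² = Σⱼ |⟨dᵢ , hⱼ⟩|². If T misses
-- row j, then hⱼ = kⱼ and ⟨dᵢ , hⱼ⟩ vanishes; otherwise Cauchy–Schwarz gives |⟨dᵢ , hⱼ⟩|² ≤ tᵢ ‖dᵢ‖²,
-- where tᵢ is the number of elements of T in row i. With r the number of rows met by T, this yields
-- n ≤ r tᵢ for each of them, and summing over these rows gives r n ≤ r |T|. The argument works over
-- any commutative ring with an involution and a compatible preorder for which x x* ≥ 0, and
-- x x* ≤ 0 only if x = 0.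

open import Algebra.Bundles using (CommutativeRing)
open import Data.Bool.Base using (if_then_else_)
open import Data.Fin.Base using (Fin; zero; suc; punchIn; punchOut; combine; remQuot)
open import Data.Fin.Properties using (_≟_; punchIn-punchOut; punchInᵢ≢i; combine-remQuot)
open import Data.Fin.Subset
  using (Subset; Nonempty; ∣_∣; inside; outside; _∈_; _∉_)
open import Data.Fin.Subset.Properties using (nonempty?; drop-there)
open import Data.Nat.Base as ℕ using (ℕ; zero; suc; _≤_; z≤n; s≤s)
import Data.Nat.Properties as ℕₚ
open import Data.Product.Base using (∃; _,_; proj₁)
open import Data.Vec.Base as Vec using (Vec; []; _∷_)
open import Data.Vec.Properties using (lookup-concat; lookup⇒[]=; []=⇒lookup)
open import Data.Vec.Functional using (Vector; removeAt; replicate)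
open import Function.Base using (_∘_)
open import Level as Level using (0ℓ; _⊔_)
open import Relation.Binary.Bundles using (Preorder)
open import Relation.Binary.Core using (Rel)
open import Relation.Binary.Structures using (IsPreorder)
open import Relation.Binary.PropositionalEquality as ≡ using (_≡_; _≢_)
import Relation.Binary.Reasoning.Preorder
import Relation.Binary.Reasoning.Setoid
open import Relation.Nullary.Decidable.Core using (Dec; yes; no; does)
open import Relation.Nullary.Decidable using (dec-true; dec-false)
open import Relation.Nullary.Negation.Core using (¬_)
import Algebra.Properties.Semiring.Sum ℕₚ.+-*-semiring as ℕΣ

-- Two obstacles shape the proof. Parseval needs the columns of H to be orthogonal, whereas a
-- Hadamard matrix is defined by its rows. The passage from H Hᴴ = n to Hᴴ H = n is made by
-- positivity, the entries of modulus 1 supplying the diagonal of Hᴴ H, so that no determinant or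
-- inverse enters. Moreover, equality and order of Cauchy reals cannot be decided, so no case
-- distinction is ever made on a complex number: cases are taken only on finite sets, indices,
-- natural numbers and rationals. Accordingly n ≤ r tᵢ is reached by refuting r tᵢ < n, which would
-- force ‖dᵢ‖² ≲ 0 against the altered entry in row i. A refutation suffices because the order of ℕ
-- is decidable.

ℕsum-mono : ∀ {n} {x y : Vector ℕ n} → (∀ i → x i ≤ y i) → ℕΣ.sum x ≤ ℕΣ.sum y
ℕsum-mono {zero}  x≤y = z≤n
ℕsum-mono {suc n} x≤y = ℕₚ.+-mono-≤ (x≤y zero) (ℕsum-mono (x≤y ∘ suc))

term≤ℕsum : ∀ {n} (x : Vector ℕ n) i → x i ≤ ℕΣ.sum x
term≤ℕsum {suc n} x zero    = ℕₚ.m≤m+n (x zero) _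
term≤ℕsum {suc n} x (suc i) = ℕₚ.≤-trans (term≤ℕsum (x ∘ suc) i) (ℕₚ.m≤n+m _ (x zero))

indicator : ∀ {a} {A : Set a} → Dec A → ℕ
indicator d = if does d then 1 else 0

-- Inequalities are scaled only by natural numbers, that is, by repeated addition; hence `+-mono-≲`
-- is the sole compatibility axiom. A relation that forgets imaginary parts can then serve as the
-- order on ℂ.
record PositiveStarRing c ℓ₁ ℓ₂ : Set (Level.suc (c ⊔ ℓ₁ ⊔ ℓ₂)) where
  infix 4 _≲_
  field
    commutativeRing : CommutativeRing c ℓ₁
  open CommutativeRing commutativeRing public
  field
    conj            : Carrier → Carrier
    conj-cong       : ∀ {x y} → x ≈ y → conj x ≈ conj y
    conj-0#         : conj 0# ≈ 0#
    conj-+          : ∀ x y → conj (x + y) ≈ conj x + conj y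
    conj-*          : ∀ x y → conj (x * y) ≈ conj x * conj y
    conj-involutive : ∀ x → conj (conj x) ≈ x
    _≲_             : Rel Carrier ℓ₂
    ≲-isPreorder    : IsPreorder _≈_ _≲_
    +-mono-≲        : ∀ {x y u v} → x ≲ y → u ≲ v → x + u ≲ y + v

  norm : Carrier → Carrier
  norm x = x * conj x

  field
    0≲norm    : ∀ x → 0# ≲ norm x
    norm≲0⇒≈0 : ∀ x → norm x ≲ 0# → x ≈ 0#

module Trades {c ℓ₁ ℓ₂} (S : PositiveStarRing c ℓ₁ ℓ₂) where
  open PositiveStarRing S hiding (zero)
  open IsPreorder ≲-isPreorder using ()
    renaming (refl to ≲-refl; reflexive to ≲-reflexive; trans to ≲-trans)
  open import Algebra.Properties.Semiring.Sum semiring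
  open import Algebra.Properties.Semiring.Mult semiring
  open import Algebra.Properties.AbelianGroup +-abelianGroup
    using (identityˡ-unique; x≈y⇒x∙y⁻¹≈ε; x∙y⁻¹≈ε⇒x≈y)
  open import Algebra.Properties.CommutativeMonoid.Mult +-commutativeMonoid using (×-distrib-+)
  open import Algebra.Solver.Ring.NaturalCoefficients.Default commutativeSemiring
    using (solve; _:=_; _:+_; _:*_)

  module ≈-Reasoning = Relation.Binary.Reasoning.Setoid setoid

  -- Inequalities between finite sums and natural multiples

  ≲-preorder : Preorder c ℓ₁ ℓ₂
  ≲-preorder = record { isPreorder = ≲-isPreorder }

  module ≲-Reasoning = Relation.Binary.Reasoning.Preorder ≲-preorder

  +-cancelˡ-≲ : ∀ x {y z} → x + y ≲ x + z → y ≲ z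
  +-cancelˡ-≲ x {y} {z} x+y≲x+z = begin
    y              ≈⟨ cancel y ⟨
    - x + (x + y)  ≲⟨ +-mono-≲ ≲-refl x+y≲x+z ⟩
    - x + (x + z)  ≈⟨ cancel z ⟩
    z              ∎
    where
    open ≲-Reasoning
    cancel : ∀ w → - x + (x + w) ≈ w
    cancel w = trans (sym (+-assoc (- x) x w))
      (trans (+-congʳ (-‿inverseˡ x)) (+-identityˡ w))

  x+y≲x⇒y≲0 : ∀ x {y} → x + y ≲ x → y ≲ 0#
  x+y≲x⇒y≲0 x x+y≲x = +-cancelˡ-≲ x (≲-trans x+y≲x (≲-reflexive (sym (+-identityʳ x))))

  0≲+ : ∀ {x y} → 0# ≲ x → 0# ≲ y → 0# ≲ x + y
  0≲+ 0≲x 0≲y = ≲-trans (≲-reflexive (sym (+-identityˡ 0#))) (+-mono-≲ 0≲x 0≲y)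

  y≲x+y : ∀ {x} y → 0# ≲ x → y ≲ x + y
  y≲x+y y 0≲x = ≲-trans (≲-reflexive (sym (+-identityˡ y))) (+-mono-≲ 0≲x ≲-refl)

  sum-mono : ∀ {n} {x y : Vector Carrier n} → (∀ i → x i ≲ y i) → sum x ≲ sum y
  sum-mono {zero}  x≲y = ≲-refl
  sum-mono {suc n} x≲y = +-mono-≲ (x≲y zero) (sum-mono (x≲y ∘ suc))

  0≲sum : ∀ {n} {x : Vector Carrier n} → (∀ i → 0# ≲ x i) → 0# ≲ sum x
  0≲sum {zero}  0≲x = ≲-refl
  0≲sum {suc n} 0≲x = 0≲+ (0≲x zero) (0≲sum (0≲x ∘ suc))

  term≲sum : ∀ {n} {x : Vector Carrier n} → (∀ i → 0# ≲ x i) → ∀ i → x i ≲ sum x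
  term≲sum {suc n} {x} 0≲x i = begin
    x i                       ≲⟨ y≲x+y (x i) (0≲sum (0≲x ∘ punchIn i)) ⟩
    sum (removeAt x i) + x i  ≈⟨ +-comm _ _ ⟩
    x i + sum (removeAt x i)  ≈⟨ sum-remove x ⟨
    sum x                     ∎
    where open ≲-Reasoning

  ×-monoʳ-≲ : ∀ n {x y} → x ≲ y → n × x ≲ n × y
  ×-monoʳ-≲ zero    x≲y = ≲-refl
  ×-monoʳ-≲ (suc n) x≲y = +-mono-≲ x≲y (×-monoʳ-≲ n x≲y)

  0≲× : ∀ n {x} → 0# ≲ x → 0# ≲ n × x
  0≲× zero    0≲x = ≲-refl
  0≲× (suc n) 0≲x = 0≲+ 0≲x (0≲× n 0≲x)

  ×-monoˡ-≲ : ∀ {m n x} → 0# ≲ x → m ≤ n → m × x ≲ n × x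
  ×-monoˡ-≲ {n = n} 0≲x z≤n = 0≲× n 0≲x
  ×-monoˡ-≲ 0≲x (s≤s m≤n)   = +-mono-≲ ≲-refl (×-monoˡ-≲ 0≲x m≤n)

  -- If n < m, then (n + 1) x ≲ m x ≲ n x, and cancelling n x gives x ≲ 0. This is where an
  -- inequality in the ring becomes one between natural numbers.
  ×-cancelʳ-≤ : ∀ {m n x} → 0# ≲ x → ¬ x ≲ 0# → m × x ≲ n × x → m ≤ n
  ×-cancelʳ-≤ {m} {n} {x} 0≲x x≴0 mx≲nx = ℕₚ.≮⇒≥ λ n<m → x≴0
    (x+y≲x⇒y≲0 (n × x) (begin
      n × x + x    ≈⟨ +-comm (n × x) x ⟩
      x + n × x    ≲⟨ ×-monoˡ-≲ 0≲x n<m ⟩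
      m × x        ≲⟨ mx≲nx ⟩
      n × x        ∎))
    where open ≲-Reasoning

  sum-×ʳ : ∀ {n} (m : Vector ℕ n) x → sum (λ i → m i × x) ≈ ℕΣ.sum m × x
  sum-×ʳ {zero}  m x = refl
  sum-×ʳ {suc n} m x = trans (+-congˡ (sum-×ʳ (m ∘ suc) x))
    (sym (×-homo-+ x (m zero) (ℕΣ.sum (m ∘ suc))))

  ×0# : ∀ m → m × 0# ≈ 0#
  ×0# m = trans (×-congʳ m (sym (zeroʳ 0#))) (trans (sym (×-comm-* m 0# 0#)) (zeroˡ _))

  sum-×ˡ : ∀ {n} m (x : Vector Carrier n) → sum (λ i → m × x i) ≈ m × sum x
  sum-×ˡ {zero}  m x = sym (×0# m)
  sum-×ˡ {suc n} m x = trans (+-congˡ (sum-×ˡ m (x ∘ suc))) (sym (×-distrib-+ (x zero) _ m))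

  sum-single : ∀ {n} (x : Vector Carrier n) i → (∀ j → j ≢ i → x j ≈ 0#) → sum x ≈ x i
  sum-single {suc n} x i x≈0 = begin
    sum x                     ≈⟨ sum-remove x ⟩
    x i + sum (removeAt x i)  ≈⟨ +-congˡ (sum-cong-≋ λ j → x≈0 (punchIn i j) (punchInᵢ≢i i j)) ⟩
    x i + sum (replicate n 0#) ≈⟨ +-congˡ (sum-replicate-zero n) ⟩
    x i + 0#                  ≈⟨ +-identityʳ (x i) ⟩
    x i                       ∎
    where open ≈-Reasoning

  -- Squared norms and the Cauchy-Schwarz inequality

  norm-cong : ∀ {x y} → x ≈ y → norm x ≈ norm y
  norm-cong x≈y = *-cong x≈y (conj-cong x≈y)

  norm-0# : norm 0# ≈ 0#
  norm-0# = zeroˡ (conj 0#)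

  -- Cancelling `norm (x i)` leaves the sum of the other norms ≲ 0. Each of them lies below that
  -- sum, the terms being nonnegative, so each is ≲ 0 and definiteness applies.
  norms-concentrated : ∀ {n} (x : Vector Carrier n) i →
    sum (norm ∘ x) ≈ norm (x i) → ∀ j → j ≢ i → x j ≈ 0#
  norms-concentrated {suc n} x i Σ≈xᵢ j j≢i =
    ≡.subst (λ k → x k ≈ 0#) (punchIn-punchOut (j≢i ∘ ≡.sym)) (norm≲0⇒≈0 _ (begin
      norm (x (punchIn i (punchOut (j≢i ∘ ≡.sym))))
        ≲⟨ term≲sum (0≲norm ∘ x ∘ punchIn i) (punchOut (j≢i ∘ ≡.sym)) ⟩
      sum (removeAt (norm ∘ x) i)
        ≲⟨ x+y≲x⇒y≲0 (norm (x i)) (≲-reflexive (trans (sym (sum-remove (norm ∘ x))) Σ≈xᵢ)) ⟩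
      0# ∎))
    where open ≲-Reasoning

  -- Over ℂ this is twice the real part of x y*, the mixed term in the expansion of |x + y|².
  cross : Carrier → Carrier → Carrier
  cross x y = x * conj y + y * conj x

  cross-congˡ : ∀ x {y z} → y ≈ z → cross x y ≈ cross x z
  cross-congˡ x y≈z = +-cong (*-congˡ (conj-cong y≈z)) (*-congʳ y≈z)

  cross-+ : ∀ x y z → cross x (y + z) ≈ cross x y + cross x z
  cross-+ x y z = trans (+-congʳ (*-congˡ (conj-+ y z)))
    (solve 6 (λ x y z x* y* z* →
        x :* (y* :+ z*) :+ (y :+ z) :* x* := (x :* y* :+ y :* x*) :+ (x :* z* :+ z :* x*))
      refl x y z (conj x) (conj y) (conj z))

  cross-0# : ∀ x → cross x 0# ≈ 0#
  cross-0# x = trans (+-cong (trans (*-congˡ conj-0#) (zeroʳ x)) (zeroˡ (conj x))) (+-identityˡ 0#)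

  norm-+ : ∀ x y → norm (x + y) ≈ norm x + cross x y + norm y
  norm-+ x y = trans (*-congˡ (conj-+ x y))
    (solve 4 (λ x y x* y* →
        (x :+ y) :* (x* :+ y*) := x :* x* :+ (x :* y* :+ y :* x*) :+ y :* y*)
      refl x y (conj x) (conj y))

  -- This is 0 ≲ |x - y|² expanded. With z = x - y as the variable and x rewritten as z + y, the
  -- expansion becomes `polarise`, an identity free of subtraction and so within reach of the
  -- semiring solver.
  cross≲norm+norm : ∀ x y → cross x y ≲ norm x + norm y
  cross≲norm+norm x y = begin
    cross x y                    ≲⟨ y≲x+y _ (0≲norm (x - y)) ⟩
    norm (x - y) + cross x y     ≈⟨ +-congˡ (cross-congʳ x-y+y≈x) ⟨
    norm (x - y) + cross (x - y + y) y  ≈⟨ polarise (x - y) y ⟩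
    norm (x - y + y) + norm y    ≈⟨ +-congʳ (norm-cong x-y+y≈x) ⟩
    norm x + norm y              ∎
    where
    open ≲-Reasoning
    cross-congʳ : ∀ {u v} → u ≈ v → cross u y ≈ cross v y
    cross-congʳ u≈v = +-cong (*-congʳ u≈v) (*-congˡ (conj-cong u≈v))
    x-y+y≈x : x - y + y ≈ x
    x-y+y≈x = trans (+-assoc x (- y) y) (trans (+-congˡ (-‿inverseˡ y)) (+-identityʳ x))
    polarise : ∀ z y → norm z + cross (z + y) y ≈ norm (z + y) + norm y
    polarise z y = trans (+-congˡ (+-congˡ (*-congˡ (conj-+ z y)))) (trans
      (solve 4 (λ z y z* y* →
          z :* z* :+ ((z :+ y) :* y* :+ y :* (z* :+ y*)) := (z :+ y) :* (z* :+ y*) :+ y :* y*)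
        refl z y (conj z) (conj y))
      (+-congʳ (*-congˡ (sym (conj-+ z y)))))

  SupportedOn : ∀ {n} → Subset n → Vector Carrier n → Set _
  SupportedOn p x = ∀ i → i ∉ p → x i ≈ 0#

  supportedOn-tail : ∀ {n b} {p : Subset n} {x : Vector Carrier (suc n)} →
    SupportedOn (b ∷ p) x → SupportedOn p (x ∘ suc)
  supportedOn-tail supp i i∉p = supp (suc i) (i∉p ∘ drop-there)

  -- The mixed terms of the induction step of Cauchy-Schwarz: each index in `p` costs one copy of
  -- `norm x`, each index outside costs nothing.
  cross-sum : ∀ {n} (p : Subset n) x y → SupportedOn p y →
    cross x (sum y) ≲ ∣ p ∣ × norm x + sum (norm ∘ y)
  cross-sum []            x y supp = ≲-reflexive (trans (cross-0# x) (sym (+-identityˡ 0#)))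
  cross-sum (outside ∷ p) x y supp = begin
    cross x (y zero + sum (y ∘ suc))
      ≈⟨ cross-congˡ x (trans (+-congʳ (supp zero λ ())) (+-identityˡ _)) ⟩
    cross x (sum (y ∘ suc))
      ≲⟨ cross-sum p x (y ∘ suc) (supportedOn-tail supp) ⟩
    ∣ p ∣ × norm x + sum (norm ∘ y ∘ suc)
      ≲⟨ +-mono-≲ ≲-refl (y≲x+y _ (0≲norm (y zero))) ⟩
    ∣ p ∣ × norm x + sum (norm ∘ y) ∎
    where open ≲-Reasoning
  cross-sum (inside ∷ p)  x y supp = begin
    cross x (y zero + sum (y ∘ suc))
      ≈⟨ cross-+ x (y zero) _ ⟩
    cross x (y zero) + cross x (sum (y ∘ suc))
      ≲⟨ +-mono-≲ (cross≲norm+norm x (y zero)) (cross-sum p x (y ∘ suc) (supportedOn-tail supp)) ⟩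
    norm x + norm (y zero) + (∣ p ∣ × norm x + sum (norm ∘ y ∘ suc))
      ≈⟨ solve 4 (λ a b c d → a :+ b :+ (c :+ d) := a :+ c :+ (b :+ d)) refl _ _ _ _ ⟩
    norm x + ∣ p ∣ × norm x + sum (norm ∘ y) ∎
    where open ≲-Reasoning

  -- Cauchy-Schwarz against the indicator vector of `p`, by induction so as to avoid division. For a
  -- new index in `p`, with q the sum of the remaining norms, the three parts of |x₀ + s|² are
  -- bounded by |x₀|², |p| |x₀|² + q and |p| q, which add up to (|p| + 1)(|x₀|² + q).
  cauchy-schwarz : ∀ {n} (p : Subset n) x → SupportedOn p x →
    norm (sum x) ≲ ∣ p ∣ × sum (norm ∘ x)
  cauchy-schwarz []            x supp = ≲-reflexive norm-0#
  cauchy-schwarz (outside ∷ p) x supp = begin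
    norm (x zero + sum (x ∘ suc))
      ≈⟨ norm-cong (trans (+-congʳ (supp zero λ ())) (+-identityˡ _)) ⟩
    norm (sum (x ∘ suc))
      ≲⟨ cauchy-schwarz p (x ∘ suc) (supportedOn-tail supp) ⟩
    ∣ p ∣ × sum (norm ∘ x ∘ suc)
      ≲⟨ ×-monoʳ-≲ ∣ p ∣ (y≲x+y _ (0≲norm (x zero))) ⟩
    ∣ p ∣ × sum (norm ∘ x) ∎
    where open ≲-Reasoning
  cauchy-schwarz (inside ∷ p)  x supp = begin
    norm (x₀ + s)
      ≈⟨ norm-+ x₀ s ⟩
    norm x₀ + cross x₀ s + norm s
      ≲⟨ +-mono-≲ (+-mono-≲ ≲-refl (cross-sum p x₀ (x ∘ suc) (supportedOn-tail supp)))
                  (cauchy-schwarz p (x ∘ suc) (supportedOn-tail supp)) ⟩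
    norm x₀ + (∣ p ∣ × norm x₀ + q) + ∣ p ∣ × q
      ≈⟨ solve 4 (λ a b c d → a :+ (b :+ c) :+ d := a :+ c :+ (b :+ d)) refl _ _ _ _ ⟩
    norm x₀ + q + (∣ p ∣ × norm x₀ + ∣ p ∣ × q)
      ≈⟨ +-congˡ (×-distrib-+ (norm x₀) q ∣ p ∣) ⟨
    norm x₀ + q + ∣ p ∣ × (norm x₀ + q) ∎
    where
    open ≲-Reasoning
    x₀ s q : Carrier
    x₀ = x zero
    s  = sum (x ∘ suc)
    q  = sum (norm ∘ x ∘ suc)

  -- Matrix algebra over the ring

  Matrix : ℕ → Set c
  Matrix n = Fin n → Fin n → Carrier

  infix 4 _≈ᴹ_
  infixl 7 _*ᴹ_
  infixr 8 _×ᴹ_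
  infix  9 _ᴴ

  _≈ᴹ_ : ∀ {n} → Matrix n → Matrix n → Set ℓ₁
  A ≈ᴹ B = ∀ i j → A i j ≈ B i j

  _*ᴹ_ : ∀ {n} → Matrix n → Matrix n → Matrix n
  (A *ᴹ B) i j = sum λ k → A i k * B k j

  _ᴴ : ∀ {n} → Matrix n → Matrix n
  (A ᴴ) i j = conj (A j i)

  𝟙ᴹ : ∀ {n} → Matrix n
  𝟙ᴹ i j = if does (i ≟ j) then 1# else 0#

  _×ᴹ_ : ∀ {n} → ℕ → Matrix n → Matrix n
  (m ×ᴹ A) i j = m × A i j

  *ᴹ-cong : ∀ {n} {A B C D : Matrix n} → A ≈ᴹ B → C ≈ᴹ D → A *ᴹ C ≈ᴹ B *ᴹ D
  *ᴹ-cong A≈B C≈D i j = sum-cong-≋ λ k → *-cong (A≈B i k) (C≈D k j)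

  *ᴹ-assoc : ∀ {n} (A B C : Matrix n) → (A *ᴹ B) *ᴹ C ≈ᴹ A *ᴹ (B *ᴹ C)
  *ᴹ-assoc A B C i j = begin
    sum (λ k → sum (λ l → A i l * B l k) * C k j)
      ≈⟨ sum-cong-≋ (λ k → *-distribʳ-sum (C k j) (λ l → A i l * B l k)) ⟩
    sum (λ k → sum (λ l → A i l * B l k * C k j))
      ≈⟨ ∑-comm (λ k l → A i l * B l k * C k j) ⟩
    sum (λ l → sum (λ k → A i l * B l k * C k j))
      ≈⟨ sum-cong-≋ (λ l → sum-cong-≋ λ k → *-assoc (A i l) (B l k) (C k j)) ⟩
    sum (λ l → sum (λ k → A i l * (B l k * C k j)))
      ≈⟨ sum-cong-≋ (λ l → *-distribˡ-sum (A i l) (λ k → B l k * C k j)) ⟨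
    sum (λ l → A i l * sum (λ k → B l k * C k j)) ∎
    where open ≈-Reasoning

  𝟙ᴹ-diagonal : ∀ {n} (i : Fin n) → 𝟙ᴹ i i ≈ 1#
  𝟙ᴹ-diagonal i rewrite dec-true (i ≟ i) ≡.refl = refl

  𝟙ᴹ-offDiagonal : ∀ {n} {i j : Fin n} → i ≢ j → 𝟙ᴹ i j ≈ 0#
  𝟙ᴹ-offDiagonal {i = i} {j} i≢j rewrite dec-false (i ≟ j) i≢j = refl

  scalar-*ᴹ : ∀ {n} m (A : Matrix n) → (m ×ᴹ 𝟙ᴹ) *ᴹ A ≈ᴹ m ×ᴹ A
  scalar-*ᴹ m A i j = begin
    sum (λ k → (m × 𝟙ᴹ i k) * A k j)
      ≈⟨ sum-single _ i (λ k k≢i → trans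
           (*-congʳ (trans (×-congʳ m (𝟙ᴹ-offDiagonal (k≢i ∘ ≡.sym))) (×0# m))) (zeroˡ _)) ⟩
    (m × 𝟙ᴹ i i) * A i j
      ≈⟨ ×-assoc-* m (𝟙ᴹ i i) (A i j) ⟩
    m × (𝟙ᴹ i i * A i j)
      ≈⟨ ×-congʳ m (trans (*-congʳ (𝟙ᴹ-diagonal i)) (*-identityˡ (A i j))) ⟩
    m × A i j ∎
    where open ≈-Reasoning

  *ᴹ-×ᴹ : ∀ {n} m (A B : Matrix n) → A *ᴹ (m ×ᴹ B) ≈ᴹ m ×ᴹ (A *ᴹ B)
  *ᴹ-×ᴹ m A B i j = trans (sum-cong-≋ λ k → ×-comm-* m (A i k) (B k j))
    (sum-×ˡ m λ k → A i k * B k j)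

  -- Serves twice: with H Hᴴ in the middle it gives G G = n G for G = Hᴴ H, and with Hᴴ H in the
  -- middle it gives Parseval.
  *ᴹ-scalar-middle : ∀ {n} m (A B C D : Matrix n) → B *ᴹ C ≈ᴹ m ×ᴹ 𝟙ᴹ →
    (A *ᴹ B) *ᴹ (C *ᴹ D) ≈ᴹ m ×ᴹ (A *ᴹ D)
  *ᴹ-scalar-middle m A B C D BC≈m i j = begin
    ((A *ᴹ B) *ᴹ (C *ᴹ D)) i j   ≈⟨ *ᴹ-assoc A B (C *ᴹ D) i j ⟩
    (A *ᴹ (B *ᴹ (C *ᴹ D))) i j   ≈⟨ *ᴹ-cong {A = A} (λ _ _ → refl) BCD≈mD i j ⟩
    (A *ᴹ (m ×ᴹ D)) i j          ≈⟨ *ᴹ-×ᴹ m A D i j ⟩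
    m × (A *ᴹ D) i j             ∎
    where
    open ≈-Reasoning
    BCD≈mD : B *ᴹ (C *ᴹ D) ≈ᴹ m ×ᴹ D
    BCD≈mD k l = trans (sym (*ᴹ-assoc B C D k l))
      (trans (*ᴹ-cong {C = D} BC≈m (λ _ _ → refl) k l) (scalar-*ᴹ m D k l))

  conj-sum : ∀ {n} (x : Vector Carrier n) → conj (sum x) ≈ sum (conj ∘ x)
  conj-sum {zero}  x = conj-0#
  conj-sum {suc n} x = trans (conj-+ (x zero) _) (+-congˡ (conj-sum (x ∘ suc)))

  ᴴ-*ᴹ : ∀ {n} (A B : Matrix n) → (A *ᴹ B) ᴴ ≈ᴹ B ᴴ *ᴹ A ᴴ
  ᴴ-*ᴹ A B i j = trans (conj-sum λ k → A j k * B k i)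
    (sum-cong-≋ λ k → trans (conj-* (A j k) (B k i)) (*-comm _ _))

  ᴴ-involutive : ∀ {n} (A : Matrix n) → A ᴴ ᴴ ≈ᴹ A
  ᴴ-involutive A i j = conj-involutive (A i j)

  *ᴹ-ᴴ-ᴴ : ∀ {n} (A B : Matrix n) → (A *ᴹ B ᴴ) ᴴ ≈ᴹ B *ᴹ A ᴴ
  *ᴹ-ᴴ-ᴴ A B i j = trans (ᴴ-*ᴹ A (B ᴴ) i j)
    (*ᴹ-cong {C = A ᴴ} (ᴴ-involutive B) (λ _ _ → refl) i j)

  -- Hadamard matrices and Parseval's identity

  Unimodular : ∀ {n} → Matrix n → Set ℓ₁
  Unimodular A = ∀ i j → norm (A i j) ≈ 1#

  record Hadamard {n} (A : Matrix n) : Set ℓ₁ where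
    field
      unimodular : Unimodular A
      gram       : A *ᴹ A ᴴ ≈ᴹ n ×ᴹ 𝟙ᴹ

  hadamard : ∀ {n} {A B : Matrix n} → Unimodular A → B ≈ᴹ A ᴴ → A *ᴹ B ≈ᴹ n ×ᴹ 𝟙ᴹ → Hadamard A
  hadamard {A = A} unimodular B≈Aᴴ AB≈n = record
    { unimodular = unimodular
    ; gram       = λ i j → trans (*ᴹ-cong {A = A} (λ _ _ → refl) (λ k l → sym (B≈Aᴴ k l)) i j) (AB≈n i j)
    }

  -- G = Hᴴ H satisfies G Gᴴ = G G = n G, and its diagonal entries are n, so in each row of G
  -- the norms already sum to the norm of the diagonal entry.
  HHᴴ⇒HᴴH : ∀ {n} (H : Matrix n) → Unimodular H →
    H *ᴹ H ᴴ ≈ᴹ n ×ᴹ 𝟙ᴹ → H ᴴ *ᴹ H ≈ᴹ n ×ᴹ 𝟙ᴹ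
  HHᴴ⇒HᴴH {n} H unimodular HHᴴ≈n = entry
    where
    G : Matrix n
    G = H ᴴ *ᴹ H

    G-diagonal : ∀ k → G k k ≈ n × 1#
    G-diagonal k = trans (sum-cong-≋ λ l → trans (*-comm _ _) (unimodular l k)) (sum-replicate n)

    Gᴴ≈G : G ᴴ ≈ᴹ G
    Gᴴ≈G k l = trans (ᴴ-*ᴹ (H ᴴ) H k l) (*ᴹ-cong {A = H ᴴ} (λ _ _ → refl) (ᴴ-involutive H) k l)

    row-norms : ∀ k → sum (norm ∘ G k) ≈ norm (G k k)
    row-norms k = begin
      (G *ᴹ G ᴴ) k k     ≈⟨ *ᴹ-cong {A = G} (λ _ _ → refl) Gᴴ≈G k k ⟩
      (G *ᴹ G) k k       ≈⟨ *ᴹ-scalar-middle n (H ᴴ) H (H ᴴ) H HHᴴ≈n k k ⟩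
      n × G k k          ≈⟨ ×-congʳ n (*-identityˡ (G k k)) ⟨
      n × (1# * G k k)   ≈⟨ ×-assoc-* n 1# (G k k) ⟨
      (n × 1#) * G k k   ≈⟨ *-cong (G-diagonal k) (Gᴴ≈G k k) ⟨
      norm (G k k)       ∎
      where open ≈-Reasoning

    entry : G ≈ᴹ n ×ᴹ 𝟙ᴹ
    entry i j with i ≟ j
    ... | yes ≡.refl = G-diagonal i
    ... | no i≢j     = trans (norms-concentrated (G i) i (row-norms i) j (i≢j ∘ ≡.sym)) (sym (×0# n))

  -- Both sides are diagonal entries: the left one is the (i, i) entry of (A Hᴴ)(A Hᴴ)ᴴ = A (Hᴴ H)
  -- Aᴴ, and the middle factor is n.
  parseval : ∀ {n} (H : Matrix n) → Unimodular H → H *ᴹ H ᴴ ≈ᴹ n ×ᴹ 𝟙ᴹ →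
    ∀ A i → sum (norm ∘ (A *ᴹ H ᴴ) i) ≈ n × sum (norm ∘ A i)
  parseval {n} H unimodular HHᴴ≈n A i = trans
    (*ᴹ-cong {A = A *ᴹ H ᴴ} (λ _ _ → refl) (*ᴹ-ᴴ-ᴴ A H) i i)
    (*ᴹ-scalar-middle n A (H ᴴ) H (A ᴴ) (HHᴴ⇒HᴴH H unimodular HHᴴ≈n) i i)

  norm-*-conj : ∀ x {y} → norm y ≈ 1# → norm (x * conj y) ≈ norm x
  norm-*-conj x {y} yy*≈1 = begin
    x * conj y * conj (x * conj y)
      ≈⟨ *-congˡ (trans (conj-* x (conj y)) (*-congˡ (conj-involutive y))) ⟩
    x * conj y * (conj x * y)
      ≈⟨ solve 4 (λ x y x* y* → x :* y* :* (x* :* y) := y :* y* :* (x :* x*)) refl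
           x y (conj x) (conj y) ⟩
    norm y * norm x
      ≈⟨ trans (*-congʳ yy*≈1) (*-identityˡ (norm x)) ⟩
    norm x ∎
    where open ≈-Reasoning

  -- The bound for a trade given row by row

  module _ {n} (H K : Matrix n) (rows : Fin n → Subset n)
    (hadamard-H : Hadamard H) (hadamard-K : Hadamard K)
    (changed : ∀ i j → j ∈ rows i → ¬ K i j ≈ H i j)
    (unchanged : ∀ i j → j ∉ rows i → K i j ≈ H i j)
    where

    open Hadamard hadamard-H using (unimodular) renaming (gram to HHᴴ≈n)
    open Hadamard hadamard-K using () renaming (gram to KKᴴ≈n)

    private
      D : Matrix n
      D i j = K i j - H i j

      rowNorm : Fin n → Carrier
      rowNorm i = sum (norm ∘ D i)

      -- Its sum is r, the number of rows met by the trade.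
      active : Vector ℕ n
      active i = indicator (nonempty? (rows i))

      size : Vector ℕ n
      size i = ∣ rows i ∣

    D-supported : ∀ i → SupportedOn (rows i) (D i)
    D-supported i k k∉ = x≈y⇒x∙y⁻¹≈ε (unchanged i k k∉)

    -- If row j is unaltered, the inner products with it of rows i of K and of H both equal n δᵢⱼ.
    DHᴴ-unchanged : ∀ i j → ¬ Nonempty (rows j) → (D *ᴹ H ᴴ) i j ≈ 0#
    DHᴴ-unchanged i j empty = identityˡ-unique _ ((H *ᴹ H ᴴ) i j) (begin
      (D *ᴹ H ᴴ) i j + (H *ᴹ H ᴴ) i j
        ≈⟨ ∑-distrib-+ (λ k → D i k * conj (H j k)) (λ k → H i k * conj (H j k)) ⟨
      sum (λ k → D i k * conj (H j k) + H i k * conj (H j k))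
        ≈⟨ sum-cong-≋ (λ k → trans (sym (distribʳ (conj (H j k)) (D i k) (H i k)))
             (*-cong (trans (+-assoc _ _ _) (trans (+-congˡ (-‿inverseˡ (H i k))) (+-identityʳ _)))
                     (conj-cong (sym (unchanged j k (empty ∘ (k ,_))))))) ⟩
      (K *ᴹ K ᴴ) i j
        ≈⟨ KKᴴ≈n i j ⟩
      n × 𝟙ᴹ i j
        ≈⟨ HHᴴ≈n i j ⟨
      (H *ᴹ H ᴴ) i j ∎)
      where open ≈-Reasoning

    -- Multiplying the entries of row i of `D` by conjugates of unimodular entries keeps their
    -- norms, so Cauchy-Schwarz on the products returns `rowNorm i` whatever j is. The factor
    -- `active j` merges this with the case where the inner product vanishes, giving one bound to
    -- sum over j.
    norm-DHᴴ : ∀ i j → norm ((D *ᴹ H ᴴ) i j) ≲ (active j ℕ.* size i) × rowNorm i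
    norm-DHᴴ i j with nonempty? (rows j)
    ... | no empty = ≲-reflexive (trans (norm-cong (DHᴴ-unchanged i j empty)) norm-0#)
    ... | yes _    = begin
      norm ((D *ᴹ H ᴴ) i j)
        ≲⟨ cauchy-schwarz (rows i) (λ k → D i k * conj (H j k))
             (λ k k∉ → trans (*-congʳ (D-supported i k k∉)) (zeroˡ _)) ⟩
      size i × sum (λ k → norm (D i k * conj (H j k)))
        ≈⟨ ×-congʳ (size i) (sum-cong-≋ λ k → norm-*-conj (D i k) (unimodular j k)) ⟩
      size i × rowNorm i
        ≈⟨ ×-congˡ (ℕₚ.*-identityˡ (size i)) ⟨
      (1 ℕ.* size i) × rowNorm i ∎
      where open ≲-Reasoning

    rowNorm-bound : ∀ i → n × rowNorm i ≲ (ℕΣ.sum active ℕ.* size i) × rowNorm i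
    rowNorm-bound i = begin
      n × rowNorm i
        ≈⟨ parseval H unimodular HHᴴ≈n D i ⟨
      sum (norm ∘ (D *ᴹ H ᴴ) i)
        ≲⟨ sum-mono (norm-DHᴴ i) ⟩
      sum (λ j → (active j ℕ.* size i) × rowNorm i)
        ≈⟨ sum-×ʳ (λ j → active j ℕ.* size i) (rowNorm i) ⟩
      ℕΣ.sum (λ j → active j ℕ.* size i) × rowNorm i
        ≈⟨ ×-congˡ (ℕΣ.*-distribʳ-sum (size i) active) ⟨
      (ℕΣ.sum active ℕ.* size i) × rowNorm i ∎
      where open ≲-Reasoning

    -- An altered entry contributes its norm to `rowNorm i`, so a sum ≲ 0 would make that entry of
    -- `D` vanish. The negated form is what `×-cancelʳ-≤` asks for.
    rowNorm≴0 : ∀ i → Nonempty (rows i) → ¬ rowNorm i ≲ 0#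
    rowNorm≴0 i (j , j∈) rowNorm≲0 = changed i j j∈ (x∙y⁻¹≈ε⇒x≈y _ _ (norm≲0⇒≈0 (D i j)
      (≲-trans (term≲sum (0≲norm ∘ D i) j) rowNorm≲0)))

    -- The factor `active i` makes the bound trivial on rows that the trade misses, where
    -- `rowNorm i` cannot be cancelled; it can thus be summed over all rows.
    row-size : ∀ i → n ℕ.* active i ≤ ℕΣ.sum active ℕ.* size i
    row-size i with nonempty? (rows i)
    ... | no _         = ℕₚ.≤-trans (ℕₚ.≤-reflexive (ℕₚ.*-zeroʳ n)) z≤n
    ... | yes nonempty = ℕₚ.≤-trans (ℕₚ.≤-reflexive (ℕₚ.*-identityʳ n))
      (×-cancelʳ-≤ (0≲sum (0≲norm ∘ D i)) (rowNorm≴0 i nonempty) (rowNorm-bound i))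

    order≤size : ∃ (λ i → Nonempty (rows i)) → n ≤ ℕΣ.sum size
    -- The sum over all rows yields r n ≤ r |T|; the given nonempty row makes r positive, so r
    -- cancels.
    order≤size (i , nonempty) = ℕₚ.*-cancelˡ-≤ (ℕΣ.sum active) {{ℕ.>-nonZero 0<active}} (begin
      ℕΣ.sum active ℕ.* n                  ≡⟨ ℕₚ.*-comm (ℕΣ.sum active) n ⟩
      n ℕ.* ℕΣ.sum active                  ≡⟨ ℕΣ.*-distribˡ-sum n active ⟩
      ℕΣ.sum (λ j → n ℕ.* active j)        ≤⟨ ℕsum-mono row-size ⟩
      ℕΣ.sum (λ j → ℕΣ.sum active ℕ.* size j)  ≡⟨ ℕΣ.*-distribˡ-sum (ℕΣ.sum active) size ⟨
      ℕΣ.sum active ℕ.* ℕΣ.sum size        ∎)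
      where
      open ℕₚ.≤-Reasoning
      active-i : active i ≡ 1
      active-i = ≡.cong (λ b → if b then 1 else 0) (dec-true (nonempty? (rows i)) nonempty)
      0<active : 0 ℕ.< ℕΣ.sum active
      0<active = ℕₚ.≤-trans (ℕₚ.≤-reflexive (≡.sym active-i)) (term≤ℕsum active i)

-- The Cauchy reals as an ordered ring

open import Defs
open import Data.Nat.Base using (ℕ; _*_; _≥_)
open import Data.Fin.Subset using (Subset; ∣_∣)
open import Algebra.Structures using (IsCommutativeRing)
open import Data.Product.Base using (_×_)
open import Data.Rational.Base as ℚ using (ℚ; 0ℚ; 1ℚ; ½)
import Data.Rational.Properties as ℚₚ
open import Data.Rational.Solver using (module +-*-Solver)
open import Data.Sum.Base using (inj₁; inj₂)
open import Relation.Binary.PropositionalEquality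
  using (refl; sym; trans; cong; subst; subst₂)

open +-*-Solver using (solve; _:=_; _:+_; _:*_; _:-_; :-_; con)

-- The shape of `_≈ℝ_` and `_≤ℝ_` at a fixed ε; facts about reals thereby reduce to facts about
-- rationals at a single index.
Eventually : (ℕ → Set) → Set
Eventually P = ∃ λ N → ∀ n → N ℕ.≤ n → P n

eventually-map : ∀ {P Q : ℕ → Set} → (∀ n → P n → Q n) → Eventually P → Eventually Q
eventually-map f (N , p) = N , λ n N≤n → f n (p n N≤n)

eventually-zip : ∀ {P Q R : ℕ → Set} → (∀ n → P n → Q n → R n) →
  Eventually P → Eventually Q → Eventually R
eventually-zip f (M , p) (N , q) = M ℕ.⊔ N , λ n M⊔N≤n →
  f n (p n (ℕₚ.m⊔n≤o⇒m≤o M N M⊔N≤n)) (q n (ℕₚ.m⊔n≤o⇒n≤o M N M⊔N≤n))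

halve : ∀ {ε} → 0ℚ ℚ.< ε → 0ℚ ℚ.< ½ ℚ.* ε
halve {ε} 0<ε = ℚₚ.positive⁻¹ _ {{ℚₚ.pos*pos⇒pos ½ ε {{ℚ.positive 0<ε}}}}

p≤∣p∣ : ∀ p → p ℚ.≤ ℚ.∣ p ∣
p≤∣p∣ p with ℚₚ.≤-total 0ℚ p
... | inj₁ 0≤p = ℚₚ.≤-reflexive (sym (ℚₚ.0≤p⇒∣p∣≡p 0≤p))
... | inj₂ p≤0 = ℚₚ.≤-trans p≤0 (ℚₚ.0≤∣p∣ p)

∣p-q∣≡∣q-p∣ : ∀ p q → ℚ.∣ p ℚ.- q ∣ ≡ ℚ.∣ q ℚ.- p ∣
∣p-q∣≡∣q-p∣ p q = trans (sym (ℚₚ.∣-p∣≡∣p∣ (p ℚ.- q)))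
  (cong ℚ.∣_∣ (solve 2 (λ p q → :- (p :- q) := q :- p) refl p q))

p-q<ε⇒p<q+ε : ∀ p q {ε} → p ℚ.- q ℚ.< ε → p ℚ.< q ℚ.+ ε
p-q<ε⇒p<q+ε p q {ε} p-q<ε = subst (ℚ._< q ℚ.+ ε)
  (solve 2 (λ p q → q :+ (p :- q) := p) refl p q) (ℚₚ.+-monoʳ-< q p-q<ε)

p<q+ε⇒p-q<ε : ∀ p q {ε} → p ℚ.< q ℚ.+ ε → p ℚ.- q ℚ.< ε
p<q+ε⇒p-q<ε p q {ε} p<q+ε = subst (p ℚ.- q ℚ.<_)
  (solve 2 (λ q ε → (q :+ ε) :- q := ε) refl q ε) (ℚₚ.+-monoˡ-< (ℚ.- q) p<q+ε)

∣p-q∣<ε⇒p<q+ε : ∀ p q {ε} → ℚ.∣ p ℚ.- q ∣ ℚ.< ε → p ℚ.< q ℚ.+ ε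
∣p-q∣<ε⇒p<q+ε p q ∣p-q∣<ε = p-q<ε⇒p<q+ε p q (ℚₚ.≤-<-trans (p≤∣p∣ _) ∣p-q∣<ε)

p<q+ε∧q<p+ε⇒∣p-q∣<ε : ∀ p q {ε} → p ℚ.< q ℚ.+ ε → q ℚ.< p ℚ.+ ε → ℚ.∣ p ℚ.- q ∣ ℚ.< ε
p<q+ε∧q<p+ε⇒∣p-q∣<ε p q {ε} p<q+ε q<p+ε with ℚₚ.∣p∣≡p∨∣p∣≡-p (p ℚ.- q)
... | inj₁ ≡+ = subst (ℚ._< ε) (sym ≡+) (p<q+ε⇒p-q<ε p q p<q+ε)
... | inj₂ ≡- = subst (ℚ._< ε)
  (sym (trans ≡- (solve 2 (λ p q → :- (p :- q) := q :- p) refl p q)))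
  (p<q+ε⇒p-q<ε q p q<p+ε)

≡⇒≤ℝ : ∀ {x y} → (∀ n → seq x n ≡ seq y n) → x ≤ℝ y
≡⇒≤ℝ {x} {y} x≡y ε 0<ε = 0 , λ n _ →
  subst (ℚ._< seq y n ℚ.+ ε) (trans (ℚₚ.+-identityʳ _) (sym (x≡y n)))
    (ℚₚ.+-monoʳ-< (seq y n) 0<ε)

≤ℝ-trans : ∀ {x y z} → x ≤ℝ y → y ≤ℝ z → x ≤ℝ z
≤ℝ-trans {x} {y} {z} x≤y y≤z ε 0<ε = eventually-zip
  (λ n x<y y<z → subst (seq x n ℚ.<_)
    (solve 2 (λ z ε → (z :+ con ½ :* ε) :+ con ½ :* ε := z :+ ε) refl (seq z n) ε)
    (ℚₚ.<-trans x<y (ℚₚ.+-monoˡ-< (½ ℚ.* ε) y<z)))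
  (x≤y _ (halve 0<ε)) (y≤z _ (halve 0<ε))

-- Transitivity of `_≈ℝ_` and its compatibility with addition are derived from those of `_≤ℝ_`
-- through this, so that ε is split into halves only for the order.
≤ℝ-antisym : ∀ {x y} → x ≤ℝ y → y ≤ℝ x → x ≈ℝ y
≤ℝ-antisym {x} {y} x≤y y≤x ε 0<ε = eventually-zip
  (λ n → p<q+ε∧q<p+ε⇒∣p-q∣<ε (seq x n) (seq y n)) (x≤y ε 0<ε) (y≤x ε 0<ε)

≤ℝ-reflexive : ∀ {x y} → x ≈ℝ y → x ≤ℝ y
≤ℝ-reflexive {x} {y} x≈y ε 0<ε =
  eventually-map (λ n → ∣p-q∣<ε⇒p<q+ε (seq x n) (seq y n)) (x≈y ε 0<ε)

-- The operations act termwise on sequences, so this reduces each ring law of ℂ to a rational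
-- identity at every index.
≡⇒≈ℝ : ∀ {x y} → (∀ n → seq x n ≡ seq y n) → x ≈ℝ y
≡⇒≈ℝ {x} {y} x≡y = ≤ℝ-antisym {x} {y} (≡⇒≤ℝ {x} {y} x≡y) (≡⇒≤ℝ {y} {x} (sym ∘ x≡y))

≈ℝ-sym : ∀ {x y} → x ≈ℝ y → y ≈ℝ x
≈ℝ-sym {x} {y} x≈y ε 0<ε = eventually-map
  (λ n → subst (ℚ._< ε) (∣p-q∣≡∣q-p∣ (seq x n) (seq y n))) (x≈y ε 0<ε)

≈ℝ-trans : ∀ {x y z} → x ≈ℝ y → y ≈ℝ z → x ≈ℝ z
≈ℝ-trans {x} {y} {z} x≈y y≈z = ≤ℝ-antisym {x} {z}
  (≤ℝ-trans {x} {y} {z} (≤ℝ-reflexive {x} {y} x≈y) (≤ℝ-reflexive {y} {z} y≈z))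
  (≤ℝ-trans {z} {y} {x} (≤ℝ-reflexive {z} {y} (≈ℝ-sym {y} {z} y≈z))
                        (≤ℝ-reflexive {y} {x} (≈ℝ-sym {x} {y} x≈y)))

+ℝ-mono : ∀ {x y u v} → x ≤ℝ y → u ≤ℝ v → x +ℝ u ≤ℝ y +ℝ v
+ℝ-mono {x} {y} {u} {v} x≤y u≤v ε 0<ε = eventually-zip
  (λ n x<y u<v → subst (seq x n ℚ.+ seq u n ℚ.<_)
    (solve 3 (λ y v ε → (y :+ con ½ :* ε) :+ (v :+ con ½ :* ε) := (y :+ v) :+ ε)
      refl (seq y n) (seq v n) ε)
    (ℚₚ.+-mono-< x<y u<v))
  (x≤y _ (halve 0<ε)) (u≤v _ (halve 0<ε))

+ℝ-cong : ∀ {x y u v} → x ≈ℝ y → u ≈ℝ v → x +ℝ u ≈ℝ y +ℝ v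
+ℝ-cong {x} {y} {u} {v} x≈y u≈v = ≤ℝ-antisym {x +ℝ u} {y +ℝ v}
  (+ℝ-mono {x} {y} {u} {v} (≤ℝ-reflexive {x} {y} x≈y) (≤ℝ-reflexive {u} {v} u≈v))
  (+ℝ-mono {y} {x} {v} {u} (≤ℝ-reflexive {y} {x} (≈ℝ-sym {x} {y} x≈y))
                           (≤ℝ-reflexive {v} {u} (≈ℝ-sym {u} {v} u≈v)))

-ℝ-cong : ∀ {x y} → x ≈ℝ y → -ℝ x ≈ℝ -ℝ y
-ℝ-cong {x} {y} x≈y ε 0<ε = eventually-map
  (λ n → subst (ℚ._< ε) (trans (∣p-q∣≡∣q-p∣ (seq x n) (seq y n))
    (cong ℚ.∣_∣ (solve 2 (λ x y → y :- x := :- x :- :- y) refl (seq x n) (seq y n)))))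
  (x≈y ε 0<ε)

-- From some index N on, the terms stay within 1 of the N-th one. The summand 1 also keeps the bound
-- positive, so that ε can be divided by it.
bounded : ∀ x → ∃ λ B → 0ℚ ℚ.< B × Eventually (λ n → ℚ.∣ seq x n ∣ ℚ.≤ B)
bounded x with cauchy x 1ℚ (ℚₚ.positive⁻¹ 1ℚ)
... | N , near = 1ℚ ℚ.+ ℚ.∣ seq x N ∣
  , ℚₚ.+-mono-<-≤ (ℚₚ.positive⁻¹ 1ℚ) (ℚₚ.0≤∣p∣ (seq x N))
  , N , λ n N≤n → begin
    ℚ.∣ seq x n ∣
      ≡⟨ cong ℚ.∣_∣ (solve 2 (λ p q → p := (p :- q) :+ q) refl (seq x n) (seq x N)) ⟩
    ℚ.∣ (seq x n ℚ.- seq x N) ℚ.+ seq x N ∣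
      ≤⟨ ℚₚ.∣p+q∣≤∣p∣+∣q∣ (seq x n ℚ.- seq x N) (seq x N) ⟩
    ℚ.∣ seq x n ℚ.- seq x N ∣ ℚ.+ ℚ.∣ seq x N ∣
      ≤⟨ ℚₚ.+-monoˡ-≤ ℚ.∣ seq x N ∣ (ℚₚ.<⇒≤ (near n N N≤n ℕₚ.≤-refl)) ⟩
    1ℚ ℚ.+ ℚ.∣ seq x N ∣ ∎
  where open ℚₚ.≤-Reasoning

quotient : ∀ ε B → 0ℚ ℚ.< ε → 0ℚ ℚ.< B → ∃ λ δ → 0ℚ ℚ.< δ × δ ℚ.* B ≡ ε
quotient ε B 0<ε 0<B = ε ℚ.* (ℚ.1/ B)
  , ℚₚ.positive⁻¹ _ {{ℚₚ.pos*pos⇒pos ε {{ℚ.positive 0<ε}} (ℚ.1/ B) {{ℚₚ.1/pos⇒pos B}}}}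
  , trans (ℚₚ.*-assoc ε (ℚ.1/ B) B)
      (trans (cong (ε ℚ.*_) (ℚₚ.*-inverseˡ B)) (ℚₚ.*-identityʳ ε))
  where
  instance
    B-positive : ℚ.Positive B
    B-positive = ℚ.positive 0<B
    B-nonZero : ℚ.NonZero B
    B-nonZero = ℚₚ.pos⇒nonZero B

∣p*r-q*r∣<δ*B : ∀ p q r {δ B} → 0ℚ ℚ.< B → ℚ.∣ p ℚ.- q ∣ ℚ.< δ → ℚ.∣ r ∣ ℚ.≤ B →
  ℚ.∣ p ℚ.* r ℚ.- q ℚ.* r ∣ ℚ.< δ ℚ.* B
∣p*r-q*r∣<δ*B p q r {δ} {B} 0<B p-q<δ r≤B = begin-strict
  ℚ.∣ p ℚ.* r ℚ.- q ℚ.* r ∣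
    ≡⟨ cong ℚ.∣_∣ (solve 3 (λ p q r → p :* r :- q :* r := (p :- q) :* r) refl p q r) ⟩
  ℚ.∣ (p ℚ.- q) ℚ.* r ∣
    ≡⟨ ℚₚ.∣p*q∣≡∣p∣*∣q∣ (p ℚ.- q) r ⟩
  ℚ.∣ p ℚ.- q ∣ ℚ.* ℚ.∣ r ∣
    ≤⟨ ℚₚ.*-monoˡ-≤-nonNeg ℚ.∣ p ℚ.- q ∣ {{ℚₚ.∣-∣-nonNeg (p ℚ.- q)}} {ℚ.∣ r ∣} {B} r≤B ⟩
  ℚ.∣ p ℚ.- q ∣ ℚ.* B
    <⟨ ℚₚ.*-monoˡ-<-pos B {{ℚ.positive 0<B}} {ℚ.∣ p ℚ.- q ∣} {δ} p-q<δ ⟩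
  δ ℚ.* B ∎
  where open ℚₚ.≤-Reasoning

-- With B an eventual bound of |z|, closeness of x and y up to ε / B is enough for the products.
*ℝ-congʳ : ∀ {x y} z → x ≈ℝ y → x *ℝ z ≈ℝ y *ℝ z
*ℝ-congʳ {x} {y} z x≈y ε 0<ε =
  let B , 0<B , z≤B = bounded z
      δ , 0<δ , δB≡ε = quotient ε B 0<ε 0<B
  in eventually-zip
    (λ n x-y<δ z≤B → subst (ℚ.∣ seq x n ℚ.* seq z n ℚ.- seq y n ℚ.* seq z n ∣ ℚ.<_) δB≡ε
      (∣p*r-q*r∣<δ*B (seq x n) (seq y n) (seq z n) 0<B x-y<δ z≤B))
    (x≈y δ 0<δ) z≤B

*ℝ-comm : ∀ x y → x *ℝ y ≈ℝ y *ℝ x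
*ℝ-comm x y = ≡⇒≈ℝ {x *ℝ y} {y *ℝ x} (λ n → ℚₚ.*-comm (seq x n) (seq y n))

*ℝ-cong : ∀ {x y u v} → x ≈ℝ y → u ≈ℝ v → x *ℝ u ≈ℝ y *ℝ v
*ℝ-cong {x} {y} {u} {v} x≈y u≈v =
  ≈ℝ-trans {x *ℝ u} {y *ℝ u} {y *ℝ v} (*ℝ-congʳ {x} {y} u x≈y)
    (≈ℝ-trans {y *ℝ u} {u *ℝ y} {y *ℝ v} (*ℝ-comm y u)
      (≈ℝ-trans {u *ℝ y} {v *ℝ y} {y *ℝ v} (*ℝ-congʳ {u} {v} y u≈v) (*ℝ-comm v y)))

0≤x*x : ∀ x → 0ℝ ≤ℝ x *ℝ x
0≤x*x x ε 0<ε = 0 , λ n _ → ℚₚ.<-≤-trans 0<ε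
  (subst (ℚ._≤ seq x n ℚ.* seq x n ℚ.+ ε) (ℚₚ.+-identityˡ ε) (ℚₚ.+-monoˡ-≤ ε (square (seq x n))))
  where
  square : ∀ p → 0ℚ ℚ.≤ p ℚ.* p
  square p with ℚₚ.≤-total 0ℚ p
  ... | inj₁ 0≤p = ℚₚ.nonNegative⁻¹ _
    {{ℚₚ.nonNeg*nonNeg⇒nonNeg p {{ℚ.nonNegative 0≤p}} p {{ℚ.nonNegative 0≤p}}}}
  ... | inj₂ p≤0 = ℚₚ.nonNegative⁻¹ _
    {{ℚₚ.nonPos*nonPos⇒nonPos p {{ℚ.nonPositive p≤0}} p {{ℚ.nonPositive p≤0}}}}

p*p<ε*ε⇒∣p∣<ε : ∀ p {ε} → 0ℚ ℚ.< ε → ℚ.∣ p ℚ.* p ∣ ℚ.< ε ℚ.* ε → ℚ.∣ p ∣ ℚ.< ε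
p*p<ε*ε⇒∣p∣<ε p {ε} 0<ε pp<εε = ℚₚ.≰⇒> λ ε≤∣p∣ → ℚₚ.<-irrefl refl (begin-strict
  ε ℚ.* ε
    ≤⟨ ℚₚ.*-monoˡ-≤-nonNeg ε {{ℚ.nonNegative (ℚₚ.<⇒≤ 0<ε)}} {ε} {ℚ.∣ p ∣} ε≤∣p∣ ⟩
  ε ℚ.* ℚ.∣ p ∣
    ≤⟨ ℚₚ.*-monoʳ-≤-nonNeg ℚ.∣ p ∣ {{ℚₚ.∣-∣-nonNeg p}} {ε} {ℚ.∣ p ∣} ε≤∣p∣ ⟩
  ℚ.∣ p ∣ ℚ.* ℚ.∣ p ∣
    ≡⟨ ℚₚ.∣p*q∣≡∣p∣*∣q∣ p p ⟨
  ℚ.∣ p ℚ.* p ∣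
    <⟨ pp<εε ⟩
  ε ℚ.* ε ∎)
  where open ℚₚ.≤-Reasoning

x*x≈0⇒x≈0 : ∀ x → x *ℝ x ≈ℝ 0ℝ → x ≈ℝ 0ℝ
x*x≈0⇒x≈0 x x*x≈0 ε 0<ε = eventually-map
  (λ n xx<εε → subst (ℚ._< ε) (cong ℚ.∣_∣ (sym (ℚₚ.+-identityʳ (seq x n))))
    (p*p<ε*ε⇒∣p∣<ε (seq x n) 0<ε
      (subst (ℚ._< ε ℚ.* ε) (cong ℚ.∣_∣ (ℚₚ.+-identityʳ (seq x n ℚ.* seq x n))) xx<εε)))
  -- Tolerance ε² for the square yields tolerance ε for x.
  (x*x≈0 (ε ℚ.* ε) (ℚₚ.positive⁻¹ _ {{ℚₚ.pos*pos⇒pos ε {{ℚ.positive 0<ε}} ε {{ℚ.positive 0<ε}}}}))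

-- The complex numbers as a positive star ring

≡⇒≈ℂ : ∀ {z w} → (∀ n → seq (re z) n ≡ seq (re w) n) → (∀ n → seq (im z) n ≡ seq (im w) n) →
  z ≈ℂ w
≡⇒≈ℂ {z} {w} re≡ im≡ = ≡⇒≈ℝ {re z} {re w} re≡ , ≡⇒≈ℝ {im z} {im w} im≡

≈ℂ-sym : ∀ {z w} → z ≈ℂ w → w ≈ℂ z
≈ℂ-sym {z} {w} (re≈ , im≈) = ≈ℝ-sym {re z} {re w} re≈ , ≈ℝ-sym {im z} {im w} im≈

≈ℂ-trans : ∀ {z w v} → z ≈ℂ w → w ≈ℂ v → z ≈ℂ v
≈ℂ-trans {z} {w} {v} (re≈ , im≈) (re≈′ , im≈′) =
  ≈ℝ-trans {re z} {re w} {re v} re≈ re≈′ , ≈ℝ-trans {im z} {im w} {im v} im≈ im≈′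

+ℂ-cong : ∀ {z w u v} → z ≈ℂ w → u ≈ℂ v → z +ℂ u ≈ℂ w +ℂ v
+ℂ-cong {z} {w} {u} {v} (re≈ , im≈) (re≈′ , im≈′) =
  +ℝ-cong {re z} {re w} {re u} {re v} re≈ re≈′ , +ℝ-cong {im z} {im w} {im u} {im v} im≈ im≈′

-ℂ-cong : ∀ {z w} → z ≈ℂ w → -ℂ z ≈ℂ -ℂ w
-ℂ-cong {z} {w} (re≈ , im≈) = -ℝ-cong {re z} {re w} re≈ , -ℝ-cong {im z} {im w} im≈

*ℂ-cong : ∀ {z w u v} → z ≈ℂ w → u ≈ℂ v → z *ℂ u ≈ℂ w *ℂ v
*ℂ-cong {a +i b} {a′ +i b′} {c +i d} {c′ +i d′} (a≈ , b≈) (c≈ , d≈) =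
    +ℝ-cong {a *ℝ c} {a′ *ℝ c′} { -ℝ (b *ℝ d)} { -ℝ (b′ *ℝ d′)}
      (*ℝ-cong {a} {a′} {c} {c′} a≈ c≈)
      (-ℝ-cong {b *ℝ d} {b′ *ℝ d′} (*ℝ-cong {b} {b′} {d} {d′} b≈ d≈))
  , +ℝ-cong {a *ℝ d} {a′ *ℝ d′} {b *ℝ c} {b′ *ℝ c′}
      (*ℝ-cong {a} {a′} {d} {d′} a≈ d≈) (*ℝ-cong {b} {b′} {c} {c′} b≈ c≈)

conj-cong : ∀ {z w} → z ≈ℂ w → conj z ≈ℂ conj w
conj-cong {z} {w} (re≈ , im≈) = re≈ , -ℝ-cong {im z} {im w} im≈

+ℂ-assoc : ∀ z w v → (z +ℂ w) +ℂ v ≈ℂ z +ℂ (w +ℂ v)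
+ℂ-assoc z w v = ≡⇒≈ℂ {(z +ℂ w) +ℂ v} {z +ℂ (w +ℂ v)}
  (λ n → ℚₚ.+-assoc (seq (re z) n) (seq (re w) n) (seq (re v) n))
  (λ n → ℚₚ.+-assoc (seq (im z) n) (seq (im w) n) (seq (im v) n))

+ℂ-comm : ∀ z w → z +ℂ w ≈ℂ w +ℂ z
+ℂ-comm z w = ≡⇒≈ℂ {z +ℂ w} {w +ℂ z}
  (λ n → ℚₚ.+-comm (seq (re z) n) (seq (re w) n))
  (λ n → ℚₚ.+-comm (seq (im z) n) (seq (im w) n))

+ℂ-identityˡ : ∀ z → 0ℂ +ℂ z ≈ℂ z
+ℂ-identityˡ z = ≡⇒≈ℂ {0ℂ +ℂ z} {z}
  (λ n → ℚₚ.+-identityˡ (seq (re z) n)) (λ n → ℚₚ.+-identityˡ (seq (im z) n))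

+ℂ-inverseˡ : ∀ z → (-ℂ z) +ℂ z ≈ℂ 0ℂ
+ℂ-inverseˡ z = ≡⇒≈ℂ {(-ℂ z) +ℂ z} {0ℂ}
  (λ n → ℚₚ.+-inverseˡ (seq (re z) n)) (λ n → ℚₚ.+-inverseˡ (seq (im z) n))

*ℂ-assoc : ∀ z w v → (z *ℂ w) *ℂ v ≈ℂ z *ℂ (w *ℂ v)
*ℂ-assoc z w v = ≡⇒≈ℂ {(z *ℂ w) *ℂ v} {z *ℂ (w *ℂ v)}
  (λ n → solve 6 (λ a b c d e f →
      (a :* c :- b :* d) :* e :- (a :* d :+ b :* c) :* f
        := a :* (c :* e :- d :* f) :- b :* (c :* f :+ d :* e))
    refl (seq (re z) n) (seq (im z) n) (seq (re w) n) (seq (im w) n) (seq (re v) n) (seq (im v) n))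
  (λ n → solve 6 (λ a b c d e f →
      (a :* c :- b :* d) :* f :+ (a :* d :+ b :* c) :* e
        := a :* (c :* f :+ d :* e) :+ b :* (c :* e :- d :* f))
    refl (seq (re z) n) (seq (im z) n) (seq (re w) n) (seq (im w) n) (seq (re v) n) (seq (im v) n))

*ℂ-comm : ∀ z w → z *ℂ w ≈ℂ w *ℂ z
*ℂ-comm z w = ≡⇒≈ℂ {z *ℂ w} {w *ℂ z}
  (λ n → solve 4 (λ a b c d → a :* c :- b :* d := c :* a :- d :* b)
    refl (seq (re z) n) (seq (im z) n) (seq (re w) n) (seq (im w) n))
  (λ n → solve 4 (λ a b c d → a :* d :+ b :* c := c :* b :+ d :* a)
    refl (seq (re z) n) (seq (im z) n) (seq (re w) n) (seq (im w) n))

*ℂ-identityˡ : ∀ z → 1ℂ *ℂ z ≈ℂ z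
*ℂ-identityˡ z = ≡⇒≈ℂ {1ℂ *ℂ z} {z}
  (λ n → solve 2 (λ a b → con 1ℚ :* a :- con 0ℚ :* b := a) refl (seq (re z) n) (seq (im z) n))
  (λ n → solve 2 (λ a b → con 1ℚ :* b :+ con 0ℚ :* a := b) refl (seq (re z) n) (seq (im z) n))

*ℂ-distribˡ-+ℂ : ∀ z w v → z *ℂ (w +ℂ v) ≈ℂ z *ℂ w +ℂ z *ℂ v
*ℂ-distribˡ-+ℂ z w v = ≡⇒≈ℂ {z *ℂ (w +ℂ v)} {z *ℂ w +ℂ z *ℂ v}
  (λ n → solve 6 (λ a b c d e f →
      a :* (c :+ e) :- b :* (d :+ f) := (a :* c :- b :* d) :+ (a :* e :- b :* f))
    refl (seq (re z) n) (seq (im z) n) (seq (re w) n) (seq (im w) n) (seq (re v) n) (seq (im v) n))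
  (λ n → solve 6 (λ a b c d e f →
      a :* (d :+ f) :+ b :* (c :+ e) := (a :* d :+ b :* c) :+ (a :* f :+ b :* e))
    refl (seq (re z) n) (seq (im z) n) (seq (re w) n) (seq (im w) n) (seq (re v) n) (seq (im v) n))

ℂ-isCommutativeRing : IsCommutativeRing _≈ℂ_ _+ℂ_ _*ℂ_ -ℂ_ 0ℂ 1ℂ
ℂ-isCommutativeRing = record
  { isRing = record
    { +-isAbelianGroup = record
      { isGroup = record
        { isMonoid = record
          { isSemigroup = record
            { isMagma = record
              { isEquivalence = record
                { refl  = λ {z} → ≡⇒≈ℂ {z} {z} (λ _ → refl) (λ _ → refl)
                ; sym   = λ {z} {w} → ≈ℂ-sym {z} {w}
                ; trans = λ {z} {w} {v} → ≈ℂ-trans {z} {w} {v}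
                }
              ; ∙-cong = λ {z} {w} {u} {v} → +ℂ-cong {z} {w} {u} {v}
              }
            ; assoc = +ℂ-assoc
            }
          ; identity = +ℂ-identityˡ , λ z →
              ≈ℂ-trans {z +ℂ 0ℂ} {0ℂ +ℂ z} {z} (+ℂ-comm z 0ℂ) (+ℂ-identityˡ z)
          }
        ; inverse = +ℂ-inverseˡ , λ z →
            ≈ℂ-trans {z +ℂ (-ℂ z)} {(-ℂ z) +ℂ z} {0ℂ} (+ℂ-comm z (-ℂ z)) (+ℂ-inverseˡ z)
        ; ⁻¹-cong = λ {z} {w} → -ℂ-cong {z} {w}
        }
      ; comm = +ℂ-comm
      }
    ; *-cong = λ {z} {w} {u} {v} → *ℂ-cong {z} {w} {u} {v}
    ; *-assoc = *ℂ-assoc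
    ; *-identity = *ℂ-identityˡ , λ z →
        ≈ℂ-trans {z *ℂ 1ℂ} {1ℂ *ℂ z} {z} (*ℂ-comm z 1ℂ) (*ℂ-identityˡ z)
    ; distrib = *ℂ-distribˡ-+ℂ , λ z w v →
        ≈ℂ-trans {(w +ℂ v) *ℂ z} {z *ℂ (w +ℂ v)} {w *ℂ z +ℂ v *ℂ z} (*ℂ-comm (w +ℂ v) z)
          (≈ℂ-trans {z *ℂ (w +ℂ v)} {z *ℂ w +ℂ z *ℂ v} {w *ℂ z +ℂ v *ℂ z} (*ℂ-distribˡ-+ℂ z w v)
            (+ℂ-cong {z *ℂ w} {w *ℂ z} {z *ℂ v} {v *ℂ z} (*ℂ-comm z w) (*ℂ-comm z v)))
    }
  ; *-comm = *ℂ-comm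
  }

∣_∣² : ℂ → ℝ
∣ z ∣² = re z *ℝ re z +ℝ im z *ℝ im z

z*conj[z]≈∣z∣² : ∀ z → z *ℂ conj z ≈ℂ ∣ z ∣² +i 0ℝ
z*conj[z]≈∣z∣² z = ≡⇒≈ℂ {z *ℂ conj z} {∣ z ∣² +i 0ℝ}
  (λ n → solve 2 (λ a b → a :* a :- b :* (:- b) := a :* a :+ b :* b)
    refl (seq (re z) n) (seq (im z) n))
  (λ n → solve 2 (λ a b → a :* (:- b) :+ b :* a := con 0ℚ)
    refl (seq (re z) n) (seq (im z) n))

0≤∣z∣² : ∀ z → 0ℝ ≤ℝ ∣ z ∣²
0≤∣z∣² z = +ℝ-mono {0ℝ} {re z *ℝ re z} {0ℝ} {im z *ℝ im z} (0≤x*x (re z)) (0≤x*x (im z))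

x*x+y*y≤0⇒x≈0 : ∀ x y → x *ℝ x +ℝ y *ℝ y ≤ℝ 0ℝ → x ≈ℝ 0ℝ
x*x+y*y≤0⇒x≈0 x y sum≤0 = x*x≈0⇒x≈0 x (≤ℝ-antisym {x *ℝ x} {0ℝ}
  (≤ℝ-trans {x *ℝ x} {x *ℝ x +ℝ 0ℝ} {0ℝ}
    (≡⇒≤ℝ {x *ℝ x} {x *ℝ x +ℝ 0ℝ} (λ n → sym (ℚₚ.+-identityʳ (seq x n ℚ.* seq x n))))
    (≤ℝ-trans {x *ℝ x +ℝ 0ℝ} {x *ℝ x +ℝ y *ℝ y} {0ℝ}
      (+ℝ-mono {x *ℝ x} {x *ℝ x} {0ℝ} {y *ℝ y} (≡⇒≤ℝ {x *ℝ x} {x *ℝ x} (λ _ → refl)) (0≤x*x y))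
      sum≤0))
  (0≤x*x x))

∣z∣²≤0⇒z≈0 : ∀ z → ∣ z ∣² ≤ℝ 0ℝ → z ≈ℂ 0ℂ
∣z∣²≤0⇒z≈0 z ∣z∣²≤0 = x*x+y*y≤0⇒x≈0 (re z) (im z) ∣z∣²≤0
  , x*x+y*y≤0⇒x≈0 (im z) (re z)
      (≤ℝ-trans {im z *ℝ im z +ℝ re z *ℝ re z} {∣ z ∣²} {0ℝ}
        (≡⇒≤ℝ {im z *ℝ im z +ℝ re z *ℝ re z} {∣ z ∣²} (λ n → ℚₚ.+-comm (seq (im z) n ℚ.* seq (im z) n) (seq (re z) n ℚ.* seq (re z) n)))
        ∣z∣²≤0)

-- ℂ is ordered by comparing real parts only; on squared moduli this is the order of ℝ.
ℂ-positiveStarRing : PositiveStarRing 0ℓ 0ℓ 0ℓ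
ℂ-positiveStarRing = record
  { commutativeRing = record
      { Carrier = ℂ ; _≈_ = _≈ℂ_ ; _+_ = _+ℂ_ ; _*_ = _*ℂ_ ; -_ = -ℂ_ ; 0# = 0ℂ ; 1# = 1ℂ
      ; isCommutativeRing = ℂ-isCommutativeRing
      }
  ; conj            = conj
  ; conj-cong       = λ {z} {w} → conj-cong {z} {w}
  ; conj-0#         = ≡⇒≈ℂ {conj 0ℂ} {0ℂ} (λ _ → refl) (λ _ → refl)
  ; conj-+          = λ z w → ≡⇒≈ℂ {conj (z +ℂ w)} {conj z +ℂ conj w} (λ _ → refl)
      (λ n → ℚₚ.neg-distrib-+ (seq (im z) n) (seq (im w) n))
  ; conj-*          = λ z w → ≡⇒≈ℂ {conj (z *ℂ w)} {conj z *ℂ conj w}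
      (λ n → solve 4 (λ a b c d → a :* c :- b :* d := a :* c :- (:- b) :* (:- d))
        refl (seq (re z) n) (seq (im z) n) (seq (re w) n) (seq (im w) n))
      (λ n → solve 4 (λ a b c d → :- (a :* d :+ b :* c) := a :* (:- d) :+ (:- b) :* c)
        refl (seq (re z) n) (seq (im z) n) (seq (re w) n) (seq (im w) n))
  ; conj-involutive = λ z → ≡⇒≈ℂ {conj (conj z)} {z} (λ _ → refl)
      (λ n → solve 1 (λ b → :- (:- b) := b) refl (seq (im z) n))
  ; _≲_             = λ z w → re z ≤ℝ re w
  ; ≲-isPreorder    = record
      { isEquivalence = IsCommutativeRing.isEquivalence ℂ-isCommutativeRing
      ; reflexive     = λ {z} {w} z≈w → ≤ℝ-reflexive {re z} {re w} (proj₁ z≈w)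
      ; trans         = λ {z} {w} {v} → ≤ℝ-trans {re z} {re w} {re v}
      }
  ; +-mono-≲        = λ {z} {w} {u} {v} → +ℝ-mono {re z} {re w} {re u} {re v}
  ; 0≲norm          = λ z → ≤ℝ-trans {0ℝ} {∣ z ∣²} {re (z *ℂ conj z)} (0≤∣z∣² z)
      (≤ℝ-reflexive {∣ z ∣²} {re (z *ℂ conj z)}
        (≈ℝ-sym {re (z *ℂ conj z)} {∣ z ∣²} (proj₁ (z*conj[z]≈∣z∣² z))))
  ; norm≲0⇒≈0       = λ z norm≲0 → ∣z∣²≤0⇒z≈0 z
      (≤ℝ-trans {∣ z ∣²} {re (z *ℂ conj z)} {0ℝ}
        (≤ℝ-reflexive {∣ z ∣²} {re (z *ℂ conj z)}
          (≈ℝ-sym {re (z *ℂ conj z)} {∣ z ∣²} (proj₁ (z*conj[z]≈∣z∣² z))))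
        norm≲0)
  }

module ℂ-Trades = Trades ℂ-positiveStarRing

-- `HasModulus` specifies the modulus by its square, and z z* has real part |z|² and imaginary part
-- 0, so modulus 1 becomes a purely algebraic condition.
modulus-1⇒z*conj[z]≈1 : ∀ z → HasModulus z 1ℝ → z *ℂ conj z ≈ℂ 1ℂ
modulus-1⇒z*conj[z]≈1 z (_ , 1*1≈∣z∣²) =
  ≈ℂ-trans {z *ℂ conj z} {∣ z ∣² +i 0ℝ} {1ℂ} (z*conj[z]≈∣z∣² z)
    ( ≈ℝ-trans {∣ z ∣²} {1ℝ *ℝ 1ℝ} {1ℝ} (≈ℝ-sym {1ℝ *ℝ 1ℝ} {∣ z ∣²} 1*1≈∣z∣²)
        (≡⇒≈ℝ {1ℝ *ℝ 1ℝ} {1ℝ} (λ _ → ℚₚ.*-identityʳ 1ℚ))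
    , ≡⇒≈ℝ {0ℝ} {0ℝ} (λ _ → refl))

-- Converting A *ᴹ A ᴴ between its forms in Defs and in ℂ-Trades directly takes Agda impractically
-- long, although they are definitionally equal; so A ᴴ is first treated as a variable B.
*ᴹ≈scalar⇒ : ∀ {n} (A B : Matrix n) m → A *ᴹ B ≈ᴹ m ×ᴹ 𝟙ᴹ →
  A ℂ-Trades.*ᴹ B ℂ-Trades.≈ᴹ m ℂ-Trades.×ᴹ ℂ-Trades.𝟙ᴹ
*ᴹ≈scalar⇒ A B m AB≈m i j = subst₂ _≈ℂ_
  (refl {x = (A *ᴹ B) i j}) (refl {x = (m ×ᴹ 𝟙ᴹ) i j}) (AB≈m i j)

isComplexHadamard⇒hadamard : ∀ {n} (A : Matrix n) → IsComplexHadamard A → ℂ-Trades.Hadamard A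
isComplexHadamard⇒hadamard {n} A (moduli , AAᴴ≈n) = ℂ-Trades.hadamard {n} {A} {A ᴴ}
  (λ i j → modulus-1⇒z*conj[z]≈1 (A i j) (moduli i j))
  (λ i j → ≡⇒≈ℂ {(A ᴴ) i j} {(A ᴴ) i j} (λ _ → refl) (λ _ → refl))
  (*ᴹ≈scalar⇒ A (A ᴴ) n AAᴴ≈n)

-- Sets of positions as lists of rows

∣p++q∣≡∣p∣+∣q∣ : ∀ {m n} (p : Subset m) (q : Subset n) → ∣ p Vec.++ q ∣ ≡ ∣ p ∣ ℕ.+ ∣ q ∣
∣p++q∣≡∣p∣+∣q∣ []            q = refl
∣p++q∣≡∣p∣+∣q∣ (outside ∷ p) q = ∣p++q∣≡∣p∣+∣q∣ p q
∣p++q∣≡∣p∣+∣q∣ (inside ∷ p)  q = cong suc (∣p++q∣≡∣p∣+∣q∣ p q)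

∣concat∣ : ∀ {m n} (rows : Vec (Subset n) m) →
  ∣ Vec.concat rows ∣ ≡ ℕΣ.sum (λ i → ∣ Vec.lookup rows i ∣)
∣concat∣ []         = refl
∣concat∣ (p ∷ rows) = trans (∣p++q∣≡∣p∣+∣q∣ p (Vec.concat rows)) (cong (∣ p ∣ ℕ.+_) (∣concat∣ rows))

-- `combine` numbers positions row by row, the order in which `Vec.concat` lays out the rows.
combine∈concat⇒∈row : ∀ {m n} (rows : Vec (Subset n) m) i j →
  combine i j ∈ Vec.concat rows → j ∈ Vec.lookup rows i
combine∈concat⇒∈row rows i j ij∈ =
  lookup⇒[]= j _ (trans (sym (lookup-concat rows i j)) ([]=⇒lookup ij∈))

∈row⇒combine∈concat : ∀ {m n} (rows : Vec (Subset n) m) i j →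
  j ∈ Vec.lookup rows i → combine i j ∈ Vec.concat rows
∈row⇒combine∈concat rows i j j∈ =
  lookup⇒[]= (combine i j) _ (trans (lookup-concat rows i j) ([]=⇒lookup j∈))

nonempty-row : ∀ {m n} (rows : Vec (Subset n) m) →
  Nonempty (Vec.concat rows) → ∃ λ i → Nonempty (Vec.lookup rows i)
nonempty-row {m} {n} rows (x , x∈) =
  let i , j = remQuot {m} n x
  in i , j , combine∈concat⇒∈row rows i j
       (subst (_∈ Vec.concat rows) (sym (combine-remQuot {m} n x)) x∈)

theorem7p3 : ∀ (n : ℕ) (H : Matrix n) (T : Subset (n * n)) →
    IsComplexHadamard H → IsTrade H T → ∣ T ∣ ≥ n
theorem7p3 n H T hadamard-H (nonempty , K , hadamard-K , changed , unchanged) =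
  -- The set is cut into n rows of length n, and its size and the trade conditions are transported
  -- along `T≡concat`.
  let rows , T≡concat = Vec.group n n T
  in subst (n ≤_) (sym (trans (cong ∣_∣ T≡concat) (∣concat∣ rows)))
    (ℂ-Trades.order≤size H K (Vec.lookup rows)
      (isComplexHadamard⇒hadamard H hadamard-H) (isComplexHadamard⇒hadamard K hadamard-K)
      (λ i j j∈ → changed i j (subst (combine i j ∈_) (sym T≡concat) (∈row⇒combine∈concat rows i j j∈)))
      (λ i j j∉ → unchanged i j λ ij∈ →
        j∉ (combine∈concat⇒∈row rows i j (subst (combine i j ∈_) T≡concat ij∈)))
      (nonempty-row rows (subst Nonempty T≡concat nonempty)))
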